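{- Let $\ell\ge 3$ be an integer, and let $G$ be a graph with no $5$-hole and no hole of length more than $\ell$. Then $$\chi(G)\le (2\ell-2)^{2^{\omega(G)}}.$$
   Context: All graphs are finite, without loops or parallel edges. A hole in $G$ is an induced subgraph which is a cycle of length (number of edges) at least four; an $n$-hole is a hole of length $n$. $\chi(G)$ is the chromatic number of $G$, and $\omega(G)$ is the size of the largest clique of $G$. -}

module Defs where

open import Data.Empty using (⊥-elim)
open import Data.Fin using (Fin; toℕ; finToFun; funToFin)
open import Data.Fin.Properties using (_≟_; all?; any?; finToFun-funToFin)
open import Data.Fin.Subset using (Subset; ∣_∣; _∈_; ⊥)
open import Data.Fin.Subset.Properties using (_∈?_; anySubset?; ∣p∣≤n; ∣⊥∣≡0; ∉⊥)
open import Data.Nat using (ℕ; zero; suc; _≤_; z≤n; s≤s; s≤s⁻¹)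
import Data.Nat as ℕ
open import Data.Nat.Properties using (m≤n⇒m<n∨m≡n)
open import Data.Product using (∃; ∃-syntax; _×_; _,_; proj₁)
open import Data.Sum using (_⊎_; inj₁; inj₂)
open import Function using (id; _⇔_; Injective)
open import Level using (0ℓ)
open import Relation.Binary using (Rel; Decidable; Symmetric; Irreflexive)
open import Relation.Binary.PropositionalEquality using (_≡_; _≢_; refl; sym; trans)
open import Relation.Nullary using (yes; no; ¬?)
open import Relation.Nullary.Decidable using (map′; _×-dec_; _→-dec_)
import Relation.Unary as U

-- A finite simple graph, up to isomorphism: its vertex set is Fin n. Decidability of
-- adjacency is what makes χ and ω below well-defined numbers constructively.
record Graph (n : ℕ) : Set₁ where
  field
    Adj    : Rel (Fin n) 0ℓ
    adj?   : Decidable Adj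
    symm   : Symmetric Adj
    irrefl : Irreflexive _≡_ Adj

-- Adjacency in the cycle 0 – 1 – … – (k ∸ 1) – 0; meaningful for k ≥ 3.
Next : ∀ {k} → Rel (Fin k) 0ℓ
Next {k} i j = toℕ j ≡ suc (toℕ i) ⊎ (suc (toℕ i) ≡ k × toℕ j ≡ 0)

CycleAdj : ∀ {k} → Rel (Fin k) 0ℓ
CycleAdj i j = Next i j ⊎ Next j i

-- A k-hole, presented by a cyclic enumeration of its vertices. Adjacency is
-- required to hold exactly along the cycle, so the subgraph is induced.
record Hole {n} (G : Graph n) (k : ℕ) : Set where
  open Graph G
  field
    length≥4  : 4 ≤ k
    vertex    : Fin k → Fin n
    injective : Injective _≡_ _≡_ vertex
    induced   : ∀ i j → Adj (vertex i) (vertex j) ⇔ CycleAdj i j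

module _ {n} (G : Graph n) where
  open Graph G

  ProperColouring : ∀ {k} → (Fin n → Fin k) → Set
  ProperColouring c = ∀ u v → Adj u v → c u ≢ c v

  Colourable : ℕ → Set
  Colourable k = ∃[ c ] ProperColouring {k} c

  Clique : Subset n → Set
  Clique S = ∀ u v → u ∈ S → v ∈ S → u ≢ v → Adj u v

  HasClique : ℕ → Set
  HasClique k = ∃[ S ] (Clique S × ∣ S ∣ ≡ k)

Least Greatest : (ℕ → Set) → ℕ → Set
Least    P k = P k × (∀ j → P j → k ≤ j)
Greatest P k = P k × (∀ j → P j → j ≤ k)

least : ∀ {P} → U.Decidable P → ∀ b → P b → ∃ (Least P)
least P? zero pb = zero , pb , λ _ _ → z≤n
least {P} P? (suc b) pb with P? zero
... | yes p0 = zero , p0 , λ _ _ → z≤n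
... | no ¬p0 with least {λ k → P (suc k)} (λ k → P? (suc k)) b pb
...   | k , pk , min = suc k , pk , λ where
          zero    p0 → ⊥-elim (¬p0 p0)
          (suc j) pj → s≤s (min j pj)

greatest : ∀ {P} → U.Decidable P → ∀ b → (∀ j → P j → j ≤ b) → P zero → ∃ (Greatest P)
greatest P? zero bound p0 = zero , p0 , bound
greatest {P} P? (suc b) bound p0 with P? (suc b)
... | yes pb = suc b , pb , bound
... | no ¬pb = greatest P? b bound′ p0
  where
  bound′ : ∀ j → P j → j ≤ b
  bound′ j pj with m≤n⇒m<n∨m≡n (bound j pj)
  ... | inj₁ j<1+b = s≤s⁻¹ j<1+b
  ... | inj₂ refl  = ⊥-elim (¬pb pj)

module _ {n} (G : Graph n) where
  open Graph G

  properColouring? : ∀ {k} → U.Decidable (ProperColouring G {k})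
  properColouring? c = all? λ u → all? λ v → adj? u v →-dec ¬? (c u ≟ c v)

  -- finToFun enumerates the functions Fin n → Fin k by Fin (k ^ n).
  colourable? : U.Decidable (Colourable G)
  colourable? k = map′
    (λ (x , p) → finToFun x , p)
    (λ (c , p) → funToFin c , λ u v uv eq → p u v uv
      (trans (sym (finToFun-funToFin c u)) (trans eq (finToFun-funToFin c v))))
    (any? λ x → properColouring? {k} (finToFun x))

  clique? : U.Decidable (Clique G)
  clique? S = all? λ u → all? λ v →
    (u ∈? S) →-dec ((v ∈? S) →-dec (¬? (u ≟ v) →-dec adj? u v))

  hasClique? : U.Decidable (HasClique G)
  hasClique? k = anySubset? λ S → clique? S ×-dec (∣ S ∣ ℕ.≟ k)

  chromaticNumber : ∃ (Least (Colourable G))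
  chromaticNumber = least colourable? n (id , λ { u .u uu refl → irrefl refl uu })

  cliqueNumber : ∃ (Greatest (HasClique G))
  cliqueNumber = greatest hasClique? n
    (λ { _ (S , _ , refl) → ∣p∣≤n S })
    (⊥ , (λ u _ u∈⊥ → ⊥-elim (∉⊥ u∈⊥)) , ∣⊥∣≡0 n)

  χ : ℕ
  χ = proj₁ chromaticNumber

  ω : ℕ
  ω = proj₁ cliqueNumber

{-# OPTIONS --safe #-}
module Submission where

-- Induction on ω. Let τ bound the chromatic number of sets with smaller clique number, so that
-- N(z) is τ-colourable for every z. Let X be a stable subset of N(z). As there is no 5-hole,
-- adjacent vertices outside N(z) have nested neighbourhoods in X; hence a clique outside N(z), all
-- of whose vertices have neighbours in X, has a common neighbour in X. The vertices outside N(z)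
-- with a neighbour in X therefore have smaller clique number, and running X through the τ colour
-- classes of N(z) gives a τ²-colouring of the second neighbourhood of z.
--
-- Split the graph into breadth-first layers. In a component of a layer D, start from a vertex x of
-- the previous layer X and grow a Gyárfás path v₁, v₂, … in D, where at each step the component of
-- the vertices not adjacent to the current vertex v is kept, and the vertices that are adjacent to
-- v or share a neighbour with v are dropped from the set where the path may leave D; this drops
-- only τ + τ² colours. After ℓ - 2 steps the path leaves D through a vertex of X not adjacent to
-- earlier vertices and returns to x through the upper layers, which is a hole longer than ℓ. So
-- every layer has few colours, and the layers alternate between two palettes.

open import Defs
open import Data.Bool using (Bool; true; false; not)
import Data.Bool.Properties as Bool
open import Data.Empty using (⊥; ⊥-elim)
open import Data.Fin using (Fin; zero; suc; toℕ; fromℕ<)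
open import Data.Fin.Properties using (_≟_; any?; fromℕ<-injective)
open import Data.Fin.Subset using (Subset; inside; outside; ∣_∣; ⁅_⁆; _∪_) renaming (_∈_ to _∈ˢ_; _∉_ to _∉ˢ_; ⊥ to ∅ˢ)
open import Data.Fin.Subset.Properties using (∣⊥∣≡0; ∉⊥; ∪-identityˡ; x∈p∪q⁻; x∈⁅y⁆⇒x≡y)
open import Data.List using (List; []; _∷_; length; lookup; filter; allFin; cartesianProduct)
open import Data.List.Membership.Propositional using (_∈_; find; lose)
open import Data.List.Membership.Propositional.Properties
  using (∈-lookup; ∈-filter⁺; ∈-filter⁻; ∈-allFin; ∈-cartesianProduct⁺)
open import Data.List.Properties using (filter-notAll)
open import Data.List.Relation.Unary.All as All using (All; []; _∷_)
open import Data.List.Relation.Unary.All.Properties using (¬Any⇒All¬)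
open import Data.List.Relation.Unary.Any as Any using (Any; here; there)
open import Data.Nat using (ℕ; zero; suc; _+_; _≤_; _<_; _*_; _∸_; _^_; z≤n; s≤s; s≤s⁻¹)
import Data.Nat.Properties as ℕₚ
open import Data.Nat.Tactic.RingSolver using (solve-∀)
open import Data.Product using (Σ-syntax; ∃-syntax; _×_; _,_; proj₁; proj₂)
open import Data.Sum as Sum using (_⊎_; inj₁; inj₂)
open import Data.Unit using (⊤; tt)
open import Data.Vec using ([]; _∷_; here; there)
open import Function using (id; _∘_; _⇔_; mk⇔; Equivalence; Injective)
open import Level using (0ℓ)
open import Relation.Binary using (Rel; Decidable; Symmetric)
open import Relation.Binary.Construct.Closure.ReflexiveTransitive as Star using (Star; ε; _◅_; _◅◅_)
open import Relation.Binary.PropositionalEquality using (_≡_; _≢_; refl; sym; trans; cong; cong₂; subst)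
open import Relation.Nullary using (¬_; yes; no; ¬?; contradiction)
open import Relation.Nullary.Decidable using (_×-dec_; _⊎-dec_; decidable-stable)
import Relation.Unary as U
open import Relation.Unary using (Pred)

-- Component labels and sizes of subsets.

resolve : ∀ {P Q : Set} → ¬ P → P ⊎ Q → Q
resolve ¬p = Sum.[ ⊥-elim ∘ ¬p , id ]

split-by : ∀ {A : Set} {P Q : Pred A 0ℓ} → U.Decidable P → ∀ {x} → Q x → (Q x × P x) ⊎ (Q x × ¬ P x)
split-by P? {x} Qx with P? x
... | yes Px = inj₁ (Qx , Px)
... | no ¬Px = inj₂ (Qx , ¬Px)

-- Union-find over all ordered pairs: an edge `a b` redirects the label of `a` to that of `b`.
-- Labels make the components decidable and let `col-fibres` reuse one palette for all of them.
components : ∀ {n} {R : Rel (Fin n) 0ℓ} → Decidable R → Symmetric R →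
  Σ[ lab ∈ (Fin n → Fin n) ] ((∀ {u v} → R u v → lab u ≡ lab v) × (∀ {u v} → lab u ≡ lab v → Star R u v))
components {n} {R} R? R-sym =
  let lab , resp , conn = merge (cartesianProduct (allFin n) (allFin n))
  in lab , (λ {u} {v} → resp (∈-cartesianProduct⁺ (∈-allFin u) (∈-allFin v))) , conn
  where
  merge : (es : List (Fin n × Fin n)) → Σ[ lab ∈ (Fin n → Fin n) ]
    ((∀ {u v} → (u , v) ∈ es → R u v → lab u ≡ lab v) × (∀ {u v} → lab u ≡ lab v → Star R u v))
  merge [] = id , (λ ()) , λ { refl → ε }
  merge ((a , b) ∷ es) with merge es | R? a b
  ... | lab , resp , conn | no ¬ab =
    lab , (λ { (here refl) ab → contradiction ab ¬ab ; (there e) → resp e }) , conn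
  ... | lab , resp , conn | yes ab = join ∘ lab , resp′ , conn′
    where
    join : Fin n → Fin n
    join r with r ≟ lab a
    ... | yes _ = lab b
    ... | no  _ = r

    resp′ : ∀ {u v} → (u , v) ∈ (a , b) ∷ es → R u v → join (lab u) ≡ join (lab v)
    resp′ (there e) uv = cong join (resp e uv)
    resp′ (here refl) _ with lab a ≟ lab a | lab b ≟ lab a
    ... | yes _ | yes _ = refl
    ... | yes _ | no  _ = refl
    ... | no ≢a | _     = contradiction refl ≢a

    conn′ : ∀ {u v} → join (lab u) ≡ join (lab v) → Star R u v
    conn′ {u} {v} eq with lab u ≟ lab a | lab v ≟ lab a
    ... | yes u≈a | yes v≈a = conn (trans u≈a (sym v≈a))
    ... | yes u≈a | no  _   = conn u≈a ◅◅ ab ◅ conn eq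
    ... | no  _   | yes v≈a = conn eq ◅◅ R-sym ab ◅ conn (sym v≈a)
    ... | no  _   | no  _   = conn eq

∣⁅x⁆∪p∣ : ∀ {n} (x : Fin n) (p : Subset n) → x ∉ˢ p → ∣ ⁅ x ⁆ ∪ p ∣ ≡ suc ∣ p ∣
∣⁅x⁆∪p∣ zero    (outside ∷ p) _   = cong (suc ∘ ∣_∣) (∪-identityˡ p)
∣⁅x⁆∪p∣ zero    (inside  ∷ p) x∉p = contradiction here x∉p
∣⁅x⁆∪p∣ (suc x) (outside ∷ p) x∉p = ∣⁅x⁆∪p∣ x p (x∉p ∘ there)
∣⁅x⁆∪p∣ (suc x) (inside  ∷ p) x∉p = cong suc (∣⁅x⁆∪p∣ x p (x∉p ∘ there))

-- Arithmetic of the bound.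

-- bound M k = M ^ (2 ^ (k + 1) - 2) bounds the chromatic number when ω ≤ k + 1 and M = 2ℓ - 2.
bound : ℕ → ℕ → ℕ
bound M zero    = 1
bound M (suc k) = M * M * (bound M k * bound M k)

-- The factor M² clears the `- 2` in the exponent and turns the recursion into squaring: q f² q = (f
-- q)² with q = M².
bound*M² : ∀ M k → bound M k * (M * M) ≡ M ^ (2 ^ suc k)
bound*M² M zero    = base M
  where
  base : ∀ M → 1 * (M * M) ≡ M * (M * 1)
  base = solve-∀
bound*M² M (suc k) = trans (square (M * M) (bound M k)) (trans (cong₂ _*_ (bound*M² M k) (bound*M² M k))
  (trans (sym (ℕₚ.^-distribˡ-+-* M e e)) (cong (λ i → M ^ (e + i)) (sym (ℕₚ.+-identityʳ e)))))
  where
  e = 2 ^ suc k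
  square : ∀ q f → q * (f * f) * q ≡ (f * q) * (f * q)
  square = solve-∀

1≤bound : ∀ {M} → 1 ≤ M → ∀ k → 1 ≤ bound M k
1≤bound 1≤M zero    = ℕₚ.≤-refl
1≤bound 1≤M (suc k) =
  ℕₚ.*-mono-≤ (ℕₚ.*-mono-≤ 1≤M 1≤M) (ℕₚ.*-mono-≤ (1≤bound 1≤M k) (1≤bound 1≤M k))

-- `M` is the normal form of `2 * ℓ ∸ 2` at ℓ = s + 2, and `K + K` counts two palettes. Since τ ≤
-- τ², it is at most (2 + 4s)τ², and hence at most (2s + 2)²τ².
step-bound : ∀ s τ → 1 ≤ τ →
  let K = τ + s * (τ + τ * τ) ; M = s + (2 + s + 0) in K + K ≤ M * M * (τ * τ)
step-bound s τ 1≤τ = begin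
  K τ + K τ                                    ≤⟨ ℕₚ.+-mono-≤ K≤ K≤ ⟩
  K′ + K′                                      ≤⟨ ℕₚ.m≤m+n (K′ + K′) _ ⟩
  K′ + K′ + (2 + 4 * s + 4 * (s * s)) * (τ * τ) ≡⟨ expand s τ ⟩
  M * M * (τ * τ)                              ∎
  where
  open ℕₚ.≤-Reasoning
  M K′ : ℕ
  M = s + (2 + s + 0)
  K′ = τ * τ + s * (τ * τ + τ * τ)
  K : ℕ → ℕ
  K τ = τ + s * (τ + τ * τ)

  τ≤τ² : τ ≤ τ * τ
  τ≤τ² = subst (_≤ τ * τ) (ℕₚ.*-identityˡ τ) (ℕₚ.*-monoˡ-≤ τ 1≤τ)

  K≤ : K τ ≤ K′
  K≤ = ℕₚ.+-mono-≤ τ≤τ² (ℕₚ.*-monoʳ-≤ s (ℕₚ.+-monoˡ-≤ (τ * τ) τ≤τ²))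

  expand : ∀ s τ → (τ * τ + s * (τ * τ + τ * τ)) + (τ * τ + s * (τ * τ + τ * τ)) +
    (2 + 4 * s + 4 * (s * s)) * (τ * τ) ≡ (s + (2 + s + 0)) * (s + (2 + s + 0)) * (τ * τ)
  expand = solve-∀

module _ {n : ℕ} (G : Graph n) where
  open Graph G

  VSet : Set₁
  VSet = Pred (Fin n) 0ℓ

  -- Colourings of vertex sets

  -- The colour function is total and constrained on `P` only: shrinking `P` keeps it, and disjoint
  -- palettes arise by shifting.
  Col : ℕ → VSet → Set
  Col k P = Σ[ c ∈ (Fin n → ℕ) ] ((∀ {u} → P u → c u < k) × (∀ {u v} → P u → P v → Adj u v → c u ≢ c v))

  col-⊆ : ∀ {k} {P Q : VSet} → (∀ {u} → P u → Q u) → Col k Q → Col k P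
  col-⊆ P⊆Q (c , c< , proper) = c , c< ∘ P⊆Q , λ Pu Pv → proper (P⊆Q Pu) (P⊆Q Pv)

  col-≤ : ∀ {j k} {P : VSet} → j ≤ k → Col j P → Col k P
  col-≤ j≤k (c , c< , proper) = c , (λ Pu → ℕₚ.≤-trans (c< Pu) j≤k) , proper

  col-∅ : ∀ {k} {P : VSet} → (∀ u → ¬ P u) → Col k P
  col-∅ ¬P = (λ _ → 0) , (λ Pu → ⊥-elim (¬P _ Pu)) , λ Pu → ⊥-elim (¬P _ Pu)

  col-∪ : ∀ {a b} {P Q : VSet} → U.Decidable P → Col a P → Col b Q → Col (a + b) (λ u → P u ⊎ Q u)
  col-∪ {a} {b} {P} {Q} P? (c , c< , c-proper) (d , d< , d-proper) = e , e< , e-proper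
    where
    e : Fin n → ℕ
    e u with P? u
    ... | yes _ = c u
    ... | no  _ = a + d u

    e< : ∀ {u} → P u ⊎ Q u → e u < a + b
    e< {u} PQu with P? u
    ... | yes Pu = ℕₚ.≤-trans (c< Pu) (ℕₚ.m≤m+n a b)
    ... | no ¬Pu = ℕₚ.+-monoʳ-< a (d< (resolve ¬Pu PQu))

    e-proper : ∀ {u v} → P u ⊎ Q u → P v ⊎ Q v → Adj u v → e u ≢ e v
    e-proper {u} {v} PQu PQv uv eq with P? u | P? v
    ... | yes Pu | yes Pv = c-proper Pu Pv uv eq
    ... | yes Pu | no  _  = ℕₚ.m+n≮m a _ (subst (_< a) eq (c< Pu))
    ... | no  _  | yes Pv = ℕₚ.m+n≮m a _ (subst (_< a) (sym eq) (c< Pv))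
    ... | no ¬Pu | no ¬Pv = d-proper (resolve ¬Pu PQu) (resolve ¬Pv PQv) uv (ℕₚ.+-cancelˡ-≡ a _ _ eq)

  col-⋃ : ∀ {k} {P : ℕ → VSet} → (∀ i → U.Decidable (P i)) → (∀ i → Col k (P i)) →
    ∀ j → Col (j * k) (λ u → ∃[ i ] (i < j × P i u))
  col-⋃ P? col zero = col-∅ λ { _ (_ , () , _) }
  col-⋃ {P = P} P? col (suc j) = col-⊆ split (col-∪ (P? j) (col j) (col-⋃ P? col j))
    where
    split : ∀ {u} → ∃[ i ] (i < suc j × P i u) → P j u ⊎ ∃[ i ] (i < j × P i u)
    split (i , s≤s i≤j , Pi) with ℕₚ.m≤n⇒m<n∨m≡n i≤j
    ... | inj₁ i<j  = inj₂ (i , i<j , Pi)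
    ... | inj₂ refl = inj₁ Pi

  col-fibres : ∀ {k} {P : VSet} (lab : Fin n → Fin n) →
    (∀ {u v} → P u → P v → Adj u v → lab u ≡ lab v) →
    (∀ r → Col k (λ u → P u × lab u ≡ r)) → Col k P
  col-fibres lab resp col =
    (λ u → proj₁ (col (lab u)) u) ,
    (λ {u} Pu → proj₁ (proj₂ (col (lab u))) (Pu , refl)) ,
    λ {u} {v} Pu Pv uv eq → proj₂ (proj₂ (col (lab u))) (Pu , refl) (Pv , sym (resp Pu Pv uv)) uv
      (trans eq (cong (λ r → proj₁ (col r) v) (sym (resp Pu Pv uv))))

  col-anticomplete : ∀ {k} {P Q : VSet} → U.Decidable P → (∀ {u v} → P u → Q v → ¬ Adj u v) →
    Col k P → Col k Q → Col k (λ u → P u ⊎ Q u)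
  col-anticomplete {k} {P} {Q} P? anti (c , c< , c-proper) (d , d< , d-proper) = e , e< , e-proper
    where
    e : Fin n → ℕ
    e u with P? u
    ... | yes _ = c u
    ... | no  _ = d u

    e< : ∀ {u} → P u ⊎ Q u → e u < k
    e< {u} PQu with P? u
    ... | yes Pu = c< Pu
    ... | no ¬Pu = d< (resolve ¬Pu PQu)

    e-proper : ∀ {u v} → P u ⊎ Q u → P v ⊎ Q v → Adj u v → e u ≢ e v
    e-proper {u} {v} PQu PQv uv with P? u | P? v
    ... | yes Pu | yes Pv = c-proper Pu Pv uv
    ... | yes Pu | no ¬Pv = ⊥-elim (anti Pu (resolve ¬Pv PQv) uv)
    ... | no ¬Pu | yes Pv = ⊥-elim (anti Pv (resolve ¬Pu PQu) (symm uv))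
    ... | no ¬Pu | no ¬Pv = d-proper (resolve ¬Pu PQu) (resolve ¬Pv PQv) uv

  col⇒colourable : ∀ {k} → Col k (λ _ → ⊤) → Colourable G k
  col⇒colourable (c , c< , proper) =
    (λ u → fromℕ< (c< {u} tt)) , λ u v uv eq → proper tt tt uv (fromℕ<-injective _ _ _ _ eq)

  -- Cliques

  -- The clique is picked vertex by vertex, each choice shrinking `P` to a neighbourhood, so a
  -- clique inside the neighbourhood of z extends by z without any counting.
  HasK : ℕ → VSet → Set
  HasK zero    P = ⊤
  HasK (suc k) P = ∃[ v ] (P v × HasK k (λ u → P u × Adj v u))

  hasK-⊆ : ∀ k {P Q : VSet} → (∀ {u} → P u → Q u) → HasK k P → HasK k Q
  hasK-⊆ zero    P⊆Q _             = tt
  hasK-⊆ (suc k) P⊆Q (v , Pv , vs) = v , P⊆Q Pv , hasK-⊆ k (λ (Pu , vu) → P⊆Q Pu , vu) vs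

  hasK⇒clique : ∀ k {P : VSet} → HasK k P →
    ∃[ S ] (Clique G S × ∣ S ∣ ≡ k × (∀ {u} → u ∈ˢ S → P u))
  hasK⇒clique zero    _ = ∅ˢ , (λ _ _ u∈ → ⊥-elim (∉⊥ u∈)) , ∣⊥∣≡0 n , ⊥-elim ∘ ∉⊥
  hasK⇒clique (suc k) {P} (v , Pv , vs) with hasK⇒clique k vs
  ... | S , clique , refl , S⊆ = ⁅ v ⁆ ∪ S , clique′ , ∣⁅x⁆∪p∣ v S (λ v∈S → irrefl refl (proj₂ (S⊆ v∈S))) , ⊆P
    where
    split : ∀ {u} → u ∈ˢ ⁅ v ⁆ ∪ S → u ≡ v ⊎ u ∈ˢ S
    split = Sum.map₁ (x∈⁅y⁆⇒x≡y v) ∘ x∈p∪q⁻ ⁅ v ⁆ S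

    clique′ : Clique G (⁅ v ⁆ ∪ S)
    clique′ a b a∈ b∈ a≢b with split a∈ | split b∈
    ... | inj₁ refl | inj₁ refl = contradiction refl a≢b
    ... | inj₁ refl | inj₂ b∈S  = proj₂ (S⊆ b∈S)
    ... | inj₂ a∈S  | inj₁ refl = symm (proj₂ (S⊆ a∈S))
    ... | inj₂ a∈S  | inj₂ b∈S  = clique a b a∈S b∈S a≢b

    ⊆P : ∀ {u} → u ∈ˢ ⁅ v ⁆ ∪ S → P u
    ⊆P u∈ with split u∈
    ... | inj₁ refl = Pv
    ... | inj₂ u∈S  = proj₁ (S⊆ u∈S)

  -- Induced paths and holes

  -- v ∷ ws is an induced path whose last vertex is its only vertex in T.
  data Path (T : VSet) : Fin n → List (Fin n) → Set where
    stop : ∀ {v} → T v → Path T v []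
    step : ∀ {v w ws} → ¬ T v → Adj v w → All (λ u → ¬ Adj v u × v ≢ u) ws →
      Path T w ws → Path T v (w ∷ ws)

  path-adj⁺ : ∀ {T v ws} → Path T v ws → ∀ i j → toℕ j ≡ suc (toℕ i) →
    Adj (lookup (v ∷ ws) i) (lookup (v ∷ ws) j)
  path-adj⁺ (step _ vw _ p) zero    (suc zero)    _  = vw
  path-adj⁺ (step _ _  _ p) (suc i) (suc j)       eq = path-adj⁺ p i j (ℕₚ.suc-injective eq)

  path-adj⁻ : ∀ {T v ws} → Path T v ws → ∀ i j →
    Adj (lookup (v ∷ ws) i) (lookup (v ∷ ws) j) → toℕ j ≡ suc (toℕ i) ⊎ toℕ i ≡ suc (toℕ j)
  path-adj⁻ p zero zero a = ⊥-elim (irrefl refl a)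
  path-adj⁻ (step _ _ _ p) zero (suc zero) a = inj₁ refl
  path-adj⁻ (step _ _ far p) zero (suc (suc j)) a = ⊥-elim (proj₁ (All.lookup far (∈-lookup j)) a)
  path-adj⁻ (step _ _ _ p) (suc zero) zero a = inj₂ refl
  path-adj⁻ (step _ _ far p) (suc (suc i)) zero a = ⊥-elim (proj₁ (All.lookup far (∈-lookup i)) (symm a))
  path-adj⁻ (step _ _ _ p) (suc i) (suc j) a = Sum.map (cong suc) (cong suc) (path-adj⁻ p i j a)

  path-injective : ∀ {T v ws} → Path T v ws → Injective _≡_ _≡_ (lookup (v ∷ ws))
  path-injective p {zero} {zero} _ = refl
  path-injective (step _ vw _ p) {zero} {suc zero} eq = ⊥-elim (irrefl eq vw)
  path-injective (step _ _ far p) {zero} {suc (suc j)} eq = ⊥-elim (proj₂ (All.lookup far (∈-lookup j)) eq)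
  path-injective (step _ vw _ p) {suc zero} {zero} eq = ⊥-elim (irrefl (sym eq) vw)
  path-injective (step _ _ far p) {suc (suc i)} {zero} eq =
    ⊥-elim (proj₂ (All.lookup far (∈-lookup i)) (sym eq))
  path-injective (step _ _ _ p) {suc i} {suc j} eq = cong suc (path-injective p eq)

  path-end : ∀ {T v ws} → Path T v ws → ∀ j → T (lookup (v ∷ ws) j) ⇔ toℕ j ≡ length ws
  path-end (stop Tv) zero = mk⇔ (λ _ → refl) (λ _ → Tv)
  path-end (step ¬Tv _ _ p) zero = mk⇔ (⊥-elim ∘ ¬Tv) (λ ())
  path-end (step _ _ _ p) (suc j) =
    mk⇔ (cong suc ∘ Equivalence.to (path-end p j)) (Equivalence.from (path-end p j) ∘ ℕₚ.suc-injective)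

  -- By `path-end` the last vertex is the only one in `T`, so `x` sees exactly `v` and the last
  -- vertex. The condition `apex` leaves out `v`, which may be adjacent to `x` without lying in `T`.
  close : ∀ {T x v ws} → Path T v ws → Adj x v → All (λ u → x ≢ u × (Adj x u ⇔ T u)) ws →
    2 ≤ length ws → Hole G (2 + length ws)
  close {T} {x} {v} {ws} p xv apex 2≤ = record
    { length≥4  = s≤s (s≤s 2≤)
    ; vertex    = vertex
    ; injective = injective
    ; induced   = λ i j → mk⇔ (adj⁻ i j) Sum.[ adj⁺ i j , symm ∘ adj⁺ j i ]
    }
    where
    m : ℕ
    m = length ws

    vertex : Fin (2 + m) → Fin n
    vertex = lookup (x ∷ v ∷ ws)

    x≢ : ∀ j → x ≢ lookup (v ∷ ws) j
    x≢ zero    eq = irrefl eq xv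
    x≢ (suc j)    = proj₁ (All.lookup apex (∈-lookup j))

    x-adj⁻ : ∀ j → Adj x (lookup (v ∷ ws) j) → CycleAdj {2 + m} zero (suc j)
    x-adj⁻ zero    _ = inj₁ (inj₁ refl)
    x-adj⁻ (suc j) a = inj₂ (inj₂ (cong (2 +_)
      (Equivalence.to (path-end p (suc j)) (Equivalence.to (proj₂ (All.lookup apex (∈-lookup j))) a)) , refl))

    injective : Injective _≡_ _≡_ vertex
    injective {zero}  {zero}  _  = refl
    injective {zero}  {suc j} eq = ⊥-elim (x≢ j eq)
    injective {suc i} {zero}  eq = ⊥-elim (x≢ i (sym eq))
    injective {suc i} {suc j} eq = cong suc (path-injective p eq)

    adj⁻ : ∀ i j → Adj (vertex i) (vertex j) → CycleAdj i j
    adj⁻ zero    zero    a = ⊥-elim (irrefl refl a)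
    adj⁻ zero    (suc j) a = x-adj⁻ j a
    adj⁻ (suc i) zero    a = Sum.swap (x-adj⁻ i (symm a))
    adj⁻ (suc i) (suc j) a = Sum.map (inj₁ ∘ cong suc) (inj₁ ∘ cong suc) (path-adj⁻ p i j a)

    adj⁺ : ∀ i j → Next i j → Adj (vertex i) (vertex j)
    adj⁺ zero          (suc zero) (inj₁ _)        = xv
    adj⁺ (suc i)       (suc j)    (inj₁ eq)       = path-adj⁺ p i j (ℕₚ.suc-injective eq)
    adj⁺ zero          zero       (inj₂ (() , _))
    adj⁺ (suc zero)    zero       (inj₂ (eq , _)) with s≤s (s≤s ()) ← subst (4 ≤_) (sym eq) (s≤s (s≤s 2≤))
    adj⁺ (suc (suc i)) zero       (inj₂ (eq , _)) =
      symm (Equivalence.from (proj₂ (All.lookup apex (∈-lookup i)))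
        (Equivalence.from (path-end p (suc i)) (ℕₚ.suc-injective (ℕₚ.suc-injective eq))))

  -- The path is cut at its last vertex equal or adjacent to `v`: heads are dropped as long as a
  -- later vertex is near.
  attach : ∀ {T W : VSet} {v w ws} → ¬ T v → Path T w ws → All W (w ∷ ws) →
    Any (λ u → Adj v u ⊎ v ≡ u) (w ∷ ws) → ∃[ us ] (Path T v us × All W us)
  attach {v = v} {w} {ws} ¬Tv p Ws near with Any.any? (λ u → adj? v u ⊎-dec v ≟ u) ws
  attach ¬Tv (step _ _ _ p) (_ ∷ Ws) _ | yes near = attach ¬Tv p Ws near
  attach ¬Tv p Ws (there near) | no ¬near = contradiction near ¬near
  attach ¬Tv p Ws (here (inj₁ vw)) | no ¬near =
    _ , step ¬Tv vw (All.map (λ ¬n → ¬n ∘ inj₁ , ¬n ∘ inj₂) (¬Any⇒All¬ _ ¬near)) p , Ws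
  attach ¬Tv p (_ ∷ Ws) (here (inj₂ refl)) | no _ = _ , p , Ws

  -- Built from the end of the walk backwards; every vertex in `T` restarts the path. `W` is
  -- recorded at the target of each edge, which exempts the starting vertex.
  shortcut : ∀ {T W : VSet} → U.Decidable T → ∀ {v t} → Star (λ a b → Adj a b × W b) v t → T t →
    ∃[ ws ] (Path T v ws × All W ws)
  shortcut T? ε Tt = [] , stop Tt , []
  shortcut T? {v} ((vw , Ww) ◅ walk) Tt with T? v | shortcut T? walk Tt
  ... | yes Tv | _           = [] , stop Tv , []
  ... | no ¬Tv | ws , p , Ws = attach ¬Tv p (Ww ∷ Ws) (here (inj₁ vw))

  -- Second neighbourhoods

  module _ (no5 : ¬ Hole G 5) {z : Fin n} {X : VSet} (X? : U.Decidable X)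
    (X-stable : ∀ {x y} → X x → X y → ¬ Adj x y) (zX : ∀ {x} → X x → Adj z x) where

    -- Otherwise there are x in `X` seen by u only and y in `X` seen by v only, and z, x, u, v, y is
    -- a 5-hole, x and y being nonadjacent because `X` is stable.
    nested : ∀ {u v} → ¬ Adj z u → ¬ Adj z v → Adj u v →
      (∀ {x} → X x → Adj u x → Adj v x) ⊎ (∀ {x} → X x → Adj v x → Adj u x)
    nested {u} {v} ¬zu ¬zv uv with any? (λ x → X? x ×-dec adj? u x ×-dec ¬? (adj? v x))
    ... | no ∄x = inj₁ λ {x} Xx ux → decidable-stable (adj? v x) (λ ¬vx → ∄x (x , Xx , ux , ¬vx))
    ... | yes (x , Xx , ux , ¬vx) = inj₂ λ {y} Xy vy → decidable-stable (adj? u y) (λ ¬uy →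
      no5 (close
        (step {T = _≡ y}
          (λ { refl → ¬uy ux }) (symm ux)
          ((¬vx ∘ symm , λ { refl → ¬zv (zX Xx) }) ∷ (X-stable Xx Xy , λ { refl → ¬uy ux }) ∷ [])
          (step (λ { refl → ¬zu (zX Xy) }) uv ((¬uy , λ { refl → ¬zu (zX Xy) }) ∷ [])
            (step (λ { refl → ¬zv (zX Xy) }) vy [] (stop refl))))
        (zX Xx)
        (((λ { refl → ¬zv uv }) , mk⇔ (⊥-elim ∘ ¬zu) (λ { refl → zX Xy })) ∷
         ((λ { refl → ¬zu (symm uv) }) , mk⇔ (⊥-elim ∘ ¬zv) (λ { refl → zX Xy })) ∷
         ((λ { refl → irrefl refl (zX Xy) }) , mk⇔ (λ _ → refl) (λ _ → zX Xy)) ∷ [])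
        (s≤s (s≤s z≤n))))

    -- The neighbourhoods in X of the vertices of a clique form a chain; u has the least one.
    common-neighbours : ∀ k {Q : VSet} → (∀ {u} → Q u → ¬ Adj z u) → HasK (suc k) Q →
      ∃[ u ] (Q u × (∀ {x} → X x → Adj u x → HasK (suc k) (λ w → Q w × Adj x w)))
    common-neighbours zero _ (v , Qv , _) = v , Qv , λ Xx vx → v , (Qv , symm vx) , tt
    common-neighbours (suc k) Q≁z (v , Qv , h)
      with common-neighbours k (Q≁z ∘ proj₁) h
    ... | u , (Qu , vu) , g with nested (Q≁z Qv) (Q≁z Qu) vu
    ...   | inj₁ v⊆u = v , Qv , λ Xx vx → v , (Qv , symm vx) ,
              hasK-⊆ (suc k) (λ ((Qw , vw) , xw) → (Qw , xw) , vw) (g Xx (v⊆u Xx vx))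
    ...   | inj₂ u⊆v = u , Qu , λ Xx ux → v , (Qv , symm (u⊆v Xx ux)) ,
              hasK-⊆ (suc k) (λ ((Qw , vw) , xw) → (Qw , xw) , vw) (g Xx ux)

  -- Gyárfás paths

  Within : VSet → Rel (Fin n) 0ℓ
  Within P u v = P u × P v × Adj u v

  within? : ∀ {P} → U.Decidable P → Decidable (Within P)
  within? P? u v = P? u ×-dec P? v ×-dec adj? u v

  within-sym : ∀ {P} → Symmetric (Within P)
  within-sym (Pu , Pv , uv) = Pv , Pu , symm uv

  -- Takes the place of connectedness of `C`: all that the path needs is a walk inside `C` from any
  -- vertex back to a neighbour of `v`.
  Attached : Fin n → VSet → Set
  Attached v C = ∀ {u} → C u → ∃[ e ] (C e × Adj v e × Star (Within C) u e)

  module _ {P : VSet} {lab : Fin n → Fin n} (resp : ∀ {u v} → Within P u v → lab u ≡ lab v) where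

    walk-label : ∀ {u v} → Star (Within P) u v → lab u ≡ lab v
    walk-label ε            = refl
    walk-label (uw ◅ walk) = trans (resp uw) (walk-label walk)

    walk-in-fibre : ∀ {r u v} → lab u ≡ r → Star (Within P) u v → Star (Within (λ w → P w × lab w ≡ r)) u v
    walk-in-fibre _  ε                         = ε
    walk-in-fibre eq ((Pu , Pw , uw) ◅ walk) =
      ((Pu , eq) , (Pw , eq′) , uw) ◅ walk-in-fibre eq′ walk
      where eq′ = trans (sym (resp (Pu , Pw , uw))) eq

  -- The walk is cut where it first meets the neighbours of `v`. There `v′` becomes the next path
  -- vertex, and its predecessor `e′` attaches it to the component of `p`.
  first-neighbour : ∀ {v p e} {C : VSet} → Star (Within C) p e → C p → ¬ Adj v p → Adj v e →
    ∃[ e′ ] ∃[ v′ ] (Star (Within (λ u → C u × ¬ Adj v u)) p e′ × C e′ × ¬ Adj v e′ ×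
      C v′ × Adj v v′ × Adj e′ v′)
  first-neighbour ε _ ¬vp ve = contradiction ve ¬vp
  first-neighbour {v} (_◅_ {j = q} (Cp , Cq , pq) walk) _ ¬vp ve with adj? v q
  ... | yes vq = _ , q , ε , Cp , ¬vp , Cq , vq , pq
  ... | no ¬vq with first-neighbour walk Cq ¬vq ve
  ...   | e′ , v′ , walk′ , rest = e′ , v′ , ((Cp , ¬vp) , (Cq , ¬vq) , pq) ◅ walk′ , rest

  -- It suffices to colour B inside each component C′ of C minus the neighbours of v.
  gyarfas-step : ∀ {k v} {C B : VSet} → U.Decidable C → U.Decidable B → Attached v C →
    (∀ {u} → B u → C u × ¬ Adj v u) →
    (∀ {v′} {C′ : VSet} → U.Decidable C′ → C v′ → Adj v v′ → (∀ {u} → C′ u → C u × ¬ Adj v u) →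
      Attached v′ C′ → Col k (λ u → B u × C′ u)) →
    Col k B
  gyarfas-step {k} {v} {C} {B} C? B? attached B⊆ col
    with components (within? (λ u → C? u ×-dec ¬? (adj? v u))) within-sym
  ... | lab , resp , conn = col-fibres lab (λ Bu Bw uw → resp (B⊆ Bu , B⊆ Bw , uw)) fibre
    where
    fibre : ∀ r → Col k (λ u → B u × lab u ≡ r)
    fibre r with any? (λ u → B? u ×-dec lab u ≟ r)
    ... | no ∄p = col-∅ (λ u Bu → ∄p (u , Bu))
    ... | yes (p , Bp , refl) with attached (proj₁ (B⊆ Bp))
    ...   | e , _ , ve , walk with first-neighbour walk (proj₁ (B⊆ Bp)) (proj₂ (B⊆ Bp)) ve
    ...     | e′ , v′ , walk′ , Ce′ , ¬ve′ , Cv′ , vv′ , e′v′ =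
      col-⊆ (λ (Bu , eq) → Bu , B⊆ Bu , eq)
        (col (λ u → (C? u ×-dec ¬? (adj? v u)) ×-dec lab u ≟ lab p) Cv′ vv′ proj₁
          (λ (_ , eq) → e′ , ((Ce′ , ¬ve′) , e′∼p) , symm e′v′ ,
            walk-in-fibre resp eq (conn (trans eq (sym e′∼p)))))
      where
      e′∼p : lab e′ ≡ lab p
      e′∼p = sym (walk-label resp walk′)

  -- Breadth-first layers.

  Linked : VSet → Rel (Fin n) 0ℓ
  Linked A x y = ∃[ a ] ∃[ b ] (A a × A b × Adj x a × Star (Within A) a b × Adj b y)

  -- A stands for the layers before the last one X, and U for the vertices not yet reached.
  record Layering (A X U : VSet) : Set where
    field
      linked : ∀ {x y} → X x → X y → x ≢ y → Linked A x y
      A∩X    : ∀ {u} → A u → ¬ X u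
      U∩A    : ∀ {u} → U u → ¬ A u
      U∩X    : ∀ {u} → U u → ¬ X u
      U≁A    : ∀ {u a} → U u → A a → ¬ Adj u a

  -- Colouring the vertices near a vertex, then a whole layer.

  module _ (no5 : ¬ Hole G 5) {k τ : ℕ}
    (col-smaller : ∀ {P : VSet} → U.Decidable P → ¬ HasK (suc k) P → Col τ P)
    {S : VSet} (S? : U.Decidable S) (¬K : ¬ HasK (suc (suc k)) S) where

    Near : Fin n → VSet
    Near z u = Adj z u ⊎ ∃[ y ] (S y × Adj z y × Adj y u)

    near? : Decidable Near
    near? z u = adj? z u ⊎-dec any? (λ y → S? y ×-dec adj? z y ×-dec adj? y u)

    col-neighbours : ∀ {z} → S z → Col τ (λ u → S u × Adj z u)
    col-neighbours {z} Sz = col-smaller (λ u → S? u ×-dec adj? z u) (λ h → ¬K (z , Sz , h))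

    col-second-neighbours : ∀ {z} → S z →
      Col (τ * τ) (λ u → S u × ¬ Adj z u × ∃[ y ] (S y × Adj z y × Adj y u))
    col-second-neighbours {z} Sz with col-neighbours Sz
    ... | c , c< , proper =
      col-⊆ (λ { (Su , ¬zu , y , Sy , zy , yu) → c y , c< (Sy , zy) , Su , ¬zu , y , (Sy , zy , refl) , yu })
        (col-⋃ class? col-class τ)
      where
      X : ℕ → VSet
      X i y = S y × Adj z y × c y ≡ i

      X? : ∀ i → U.Decidable (X i)
      X? i y = S? y ×-dec adj? z y ×-dec c y ℕₚ.≟ i

      Class : ℕ → VSet
      Class i u = S u × ¬ Adj z u × ∃[ y ] (X i y × Adj y u)

      class? : ∀ i → U.Decidable (Class i)
      class? i u = S? u ×-dec ¬? (adj? z u) ×-dec any? (λ y → X? i y ×-dec adj? y u)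

      X-stable : ∀ i {x y} → X i x → X i y → ¬ Adj x y
      X-stable i (Sx , zx , eq) (Sy , zy , eq′) xy = proper (Sx , zx) (Sy , zy) xy (trans eq (sym eq′))

      -- The clique vertex u with least neighbourhood has some neighbour y in `X i`; y then sees a
      -- clique of size k + 1 in the class, giving one of size k + 2 in `S`.
      ¬K-class : ∀ i → ¬ HasK (suc k) (Class i)
      ¬K-class i h with common-neighbours no5 (X? i) (X-stable i) (proj₁ ∘ proj₂) k (proj₁ ∘ proj₂) h
      ... | u , (_ , _ , y , Xy , yu) , g =
        ¬K (y , proj₁ Xy , hasK-⊆ (suc k) (λ ((Sw , _) , yw) → Sw , yw) (g Xy (symm yu)))

      col-class : ∀ i → Col τ (Class i)
      col-class i = col-smaller (class? i) (¬K-class i)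

    κ : ℕ
    κ = τ + τ * τ

    col-near : ∀ {z} → S z → Col κ (λ u → S u × Near z u)
    col-near {z} Sz = col-⊆ split
      (col-∪ (λ u → S? u ×-dec adj? z u) (col-neighbours Sz) (col-second-neighbours Sz))
      where
      split : ∀ {u} → S u × Near z u → (S u × Adj z u) ⊎ (S u × ¬ Adj z u × ∃[ y ] (S y × Adj z y × Adj y u))
      split (Su , inj₁ zu) = inj₁ (Su , zu)
      split {u} (Su , inj₂ via) with adj? z u
      ... | yes zu = inj₁ (Su , zu)
      ... | no ¬zu = inj₂ (Su , ¬zu , via)

    -- Here `s` is ℓ - 2, the number of steps of the Gyárfás path.
    module _ {s : ℕ} (1≤s : 1 ≤ s) (no-long : ∀ m → 2 + s < m → ¬ Hole G m) where

      module _ {A X D : VSet} (layering : Layering A X D) (D? : U.Decidable D)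
        (X⊆S : ∀ {u} → X u → S u) (D⊆S : ∀ {u} → D u → S u)
        (covered : ∀ {d} → D d → ∃[ y ] (X y × Adj y d)) where

        open Layering layering

        -- The vertices a continuation of the path may use. An exit through `X` must see `B`, from
        -- which everything sharing a neighbour with an earlier path vertex was removed; so no
        -- earlier path vertex sees the exit.
        Allowed : VSet → VSet → VSet
        Allowed C B w = C w ⊎ A w ⊎ (X w × ∃[ b ] (B b × Adj w b))

        module _ {x : Fin n} (Xx : X x) where

          -- The path is to end where it can return to `x`. Excluding `D` spares the first path
          -- vertex, which is adjacent to `x` but lies in `D`.
          T : VSet
          T u = Adj x u × ¬ D u

          -- C contains the rest of the path to be built from v, and B the vertices of C having no
          -- neighbour in X that is adjacent to an earlier vertex of the path.
          gyarfas : ∀ t {v} {C B : VSet} → U.Decidable C → U.Decidable B → D v → ¬ C v →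
            (∀ {u} → C u → D u) → (∀ {u} → C u → ¬ Adj x u) → (∀ {u} → B u → C u) → Attached v C →
            (∀ {ws} → Path T v ws → All (Allowed C B) ws → ¬ t < length ws) →
            Col (t * κ) B
          gyarfas zero {v} {C} {B} C? B? Dv ¬Cv C⊆D x≁C B⊆C attached no-path with any? B?
          ... | no ∄b = col-∅ (λ u Bu → ∄b (u , Bu))
          ... | yes (p , Bp) with attached (B⊆C Bp) | covered (C⊆D (B⊆C Bp))
          ...   | e , Ce , ve , walk | y , Xy , yp
            with linked Xy Xx (λ { refl → x≁C (B⊆C Bp) yp })
          ...   | a , b , Aa , Ab , ya , walk′ , bx
            -- With no steps left `B` must be empty: from p in `B` the walk goes v, e, through `C`
            -- to p, up to y, then through `A` to b, a neighbour of x outside `D`.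
            with shortcut (λ u → adj? x u ×-dec ¬? (D? u)) {v}
                   ((ve , inj₁ Ce) ◅
                    Star.map (λ (_ , Cu , uw) → uw , inj₁ Cu) (Star.reverse within-sym walk) ◅◅
                    (symm yp , inj₂ (inj₂ (Xy , p , Bp , yp))) ◅
                    (ya , inj₂ (inj₁ Aa)) ◅
                    Star.map (λ (_ , Au , uw) → uw , inj₂ (inj₁ Au)) walk′)
                   (symm bx , λ Db → U∩A Db Ab)
          ...   | [] , stop (_ , ¬Dv) , _ = contradiction Dv ¬Dv
          ...   | w ∷ ws , path , allowed = ⊥-elim (no-path path allowed (s≤s z≤n))
          gyarfas (suc t) {v} {C} {B} C? B? Dv ¬Cv C⊆D x≁C B⊆C attached no-path =
            col-⊆ (split-by {Q = B} (near? v)) (col-∪ (λ u → B? u ×-dec near? v u)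
              (col-⊆ (λ (Bu , near) → D⊆S (C⊆D (B⊆C Bu)) , near) (col-near (D⊆S Dv)))
              (gyarfas-step C? far? attached (λ (Bu , ¬near) → B⊆C Bu , ¬near ∘ inj₁)
                λ C′? Cv′ vv′ C′⊆ attached′ →
                  gyarfas t C′? (λ u → far? u ×-dec C′? u) (C⊆D Cv′) (λ C′v′ → proj₂ (C′⊆ C′v′) vv′)
                    (C⊆D ∘ proj₁ ∘ C′⊆) (x≁C ∘ proj₁ ∘ C′⊆) proj₂ attached′
                    (λ path allowed t< → no-path
                      (step (λ (_ , ¬Dv) → ¬Dv Dv) vv′ (All.map (avoids C′⊆) allowed) path)
                      (inj₁ Cv′ ∷ All.map (widen C′⊆) allowed) (s≤s t<))))
            where
            Far : VSet
            Far u = B u × ¬ Near v u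

            far? : U.Decidable Far
            far? u = B? u ×-dec ¬? (near? v u)

            module _ {C′ : VSet} (C′⊆ : ∀ {u} → C′ u → C u × ¬ Adj v u) where

              avoids : ∀ {u} → Allowed C′ (λ w → Far w × C′ w) u → ¬ Adj v u × v ≢ u
              avoids (inj₁ C′u) = proj₂ (C′⊆ C′u) , λ { refl → ¬Cv (proj₁ (C′⊆ C′u)) }
              avoids (inj₂ (inj₁ Au)) = U≁A Dv Au , λ { refl → U∩A Dv Au }
              -- If `v` saw this exit vertex, b would share it as a neighbour with `v` and so be
              -- near `v`.
              avoids (inj₂ (inj₂ (Xu , b , ((_ , ¬near) , _) , ub))) =
                (λ vu → ¬near (inj₂ (_ , X⊆S Xu , vu , ub))) , λ { refl → U∩X Dv Xu }

              widen : ∀ {u} → Allowed C′ (λ w → Far w × C′ w) u → Allowed C B u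
              widen (inj₁ C′u) = inj₁ (proj₁ (C′⊆ C′u))
              widen (inj₂ (inj₁ Au)) = inj₂ (inj₁ Au)
              widen (inj₂ (inj₂ (Xu , b , ((Bb , _) , _) , ub))) = inj₂ (inj₂ (Xu , b , Bb , ub))

        col-layer : Col (τ + s * κ) D
        col-layer with components (within? D?) within-sym
        ... | lab , resp , conn = col-fibres lab (λ Du Dw uw → resp (Du , Dw , uw)) fibre
          where
          fibre : ∀ r → Col (τ + s * κ) (λ u → D u × lab u ≡ r)
          fibre r with any? (λ u → D? u ×-dec lab u ≟ r)
          ... | no ∄p = col-∅ (λ u Du → ∄p (u , Du))
          ... | yes (p , Dp , refl) with covered Dp
          ...   | x , Xx , xp =
            col-⊆ (split-by {Q = C} (adj? x)) (col-∪ (λ u → C? u ×-dec adj? x u)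
              (col-⊆ (λ ((Du , _) , xu) → D⊆S Du , xu) (col-neighbours (X⊆S Xx)))
              (gyarfas-step C? far? attached id
                λ C′? (Dv′ , _) xv′ C′⊆ attached′ →
                  gyarfas Xx s C′? (λ u → far? u ×-dec C′? u) Dv′ (λ C′v′ → proj₂ (C′⊆ C′v′) xv′)
                    (proj₁ ∘ proj₁ ∘ C′⊆) (proj₂ ∘ C′⊆) proj₂ attached′
                    -- With `x` the path `v′ ∷ ws` closes to a hole of length 2 + |ws|, which
                    -- exceeds 2 + s = ℓ.
                    (λ path allowed s< → no-long _ (s≤s (s≤s s<))
                      (close path xv′ (All.map (apex C′⊆) allowed) (ℕₚ.≤-trans (s≤s 1≤s) s<)))))
            where
            C Far : VSet
            C u = D u × lab u ≡ lab p
            Far u = C u × ¬ Adj x u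

            C? : U.Decidable C
            C? u = D? u ×-dec lab u ≟ lab p

            far? : U.Decidable Far
            far? u = C? u ×-dec ¬? (adj? x u)

            attached : Attached x C
            attached (_ , eq) = p , (Dp , refl) , xp , walk-in-fibre resp eq (conn eq)

            apex : ∀ {C′ : VSet} → (∀ {u} → C′ u → C u × ¬ Adj x u) →
              ∀ {u} → Allowed C′ (λ w → Far w × C′ w) u → x ≢ u × (Adj x u ⇔ T Xx u)
            apex C′⊆ (inj₁ C′u) =
              (λ { refl → U∩X (proj₁ (proj₁ (C′⊆ C′u))) Xx }) ,
              mk⇔ (⊥-elim ∘ proj₂ (C′⊆ C′u)) proj₁
            apex C′⊆ (inj₂ (inj₁ Au)) =
              (λ { refl → A∩X Au Xx }) , mk⇔ (λ xu → xu , λ Du → U∩A Du Au) proj₁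
            apex C′⊆ (inj₂ (inj₂ (Xu , b , ((_ , ¬xb) , _) , ub))) =
              (λ { refl → ¬xb ub }) , mk⇔ (λ xu → xu , λ Du → U∩X Du Xu) proj₁

      -- Two palettes for alternating layers.

      K : ℕ
      K = τ + s * κ

      -- The two values of β are the parities of the layers.
      Alternating : List (Fin n) → VSet → Bool → Set
      Alternating us D b = Σ[ β ∈ (Fin n → Bool) ]
        ((∀ b′ → Col K (λ u → u ∈ us × β u ≡ b′)) × (∀ {u} → u ∈ us → D u → β u ≡ b))

      -- Two vertices of `D` are linked through a common parent in `X`, or through two parents and
      -- their own link. Nothing unreached sees `X`, since `D` took all such vertices.
      next-layer : ∀ {A X us} {D : VSet} → Layering A X (_∈ us) →
        (∀ {u} → D u → u ∈ us) → (∀ {u} → D u → ∃[ x ] (X x × Adj x u)) →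
        (∀ {u x} → u ∈ us → X x → Adj x u → D u) → (D? : U.Decidable D) →
        Layering (λ u → A u ⊎ X u) D (_∈ filter (¬? ∘ D?) us)
      next-layer {A} {X} {us} {D} layering D⊆us covered D-all D? = record
        { linked = linked′
        ; A∩X    = λ AXu Du → unreached (D⊆us Du) AXu
        ; U∩A    = λ u∈ → unreached (proj₁ (unfilter u∈))
        ; U∩X    = λ u∈ → proj₂ (unfilter u∈)
        ; U≁A    = U≁A′
        }
        where
        open Layering layering

        unfilter : ∀ {u} → u ∈ filter (¬? ∘ D?) us → u ∈ us × ¬ D u
        unfilter = ∈-filter⁻ (¬? ∘ D?)

        unreached : ∀ {u} → u ∈ us → ¬ (A u ⊎ X u)
        unreached u∈ = Sum.[ U∩A u∈ , U∩X u∈ ]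

        U≁A′ : ∀ {u a} → u ∈ filter (¬? ∘ D?) us → A a ⊎ X a → ¬ Adj u a
        U≁A′ u∈ (inj₁ Aa) ua = U≁A (proj₁ (unfilter u∈)) Aa ua
        U≁A′ u∈ (inj₂ Xa) ua = proj₂ (unfilter u∈) (D-all (proj₁ (unfilter u∈)) Xa (symm ua))

        linked′ : ∀ {u v} → D u → D v → u ≢ v → Linked (λ w → A w ⊎ X w) u v
        linked′ Du Dv _ with covered Du | covered Dv
        ... | x , Xx , xu | y , Xy , yv with x ≟ y
        ...   | yes refl = x , x , inj₂ Xx , inj₂ Xx , symm xu , ε , yv
        ...   | no x≢y with linked Xx Xy x≢y
        ...     | a , b , Aa , Ab , xa , walk , by =
          x , y , inj₂ Xx , inj₂ Xy , symm xu ,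
          ((inj₂ Xx , inj₁ Aa , xa) ◅
           Star.map (λ (Au , Aw , uw) → inj₁ Au , inj₁ Aw , uw) walk ◅◅
           (inj₁ Ab , inj₂ Xy , by) ◅ ε) ,
          yv

      first-layer : ∀ z us → Layering (λ _ → ⊥) (_≡ z) (_∈ filter (λ u → ¬? (u ≟ z)) us)
      first-layer z us = record
        { linked = λ { refl refl z≢z → contradiction refl z≢z }
        ; A∩X    = λ ()
        ; U∩A    = λ _ ()
        ; U∩X    = λ u∈ → proj₂ (∈-filter⁻ (λ u → ¬? (u ≟ z)) {xs = us} u∈)
        ; U≁A    = λ _ ()
        }

      col-singleton : 1 ≤ τ → ∀ z → Col K (_≡ z)
      col-singleton 1≤τ z =
        (λ _ → 0) , (λ _ → ℕₚ.≤-trans 1≤τ (ℕₚ.m≤m+n τ _)) , λ { refl refl zz → ⊥-elim (irrefl refl zz) }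

      module _ (1≤τ : 1 ≤ τ) where

        -- The recursion measure `m` bounds the number of unreached vertices; every round removes a
        -- nonempty layer.
        alternate : ∀ m {A X} us → length us ≤ m → U.Decidable X → Layering A X (_∈ us) →
          (∀ {u} → X u → S u) → (∀ {u} → u ∈ us → S u) →
          ∀ b → Alternating us (λ u → ∃[ x ] (X x × Adj x u)) b

        -- The recursion gives parity `not b` to the remaining vertices that see `D`. Hence `D` is
        -- anticomplete to the remaining vertices of parity `b`, and the same `K` colours serve
        -- both.
        alternate-from : ∀ m {A D us} → length us ≤ suc m → (D? : U.Decidable D) →
          Any D us → (∀ {u} → D u → u ∈ us) → Col K D → Layering A D (_∈ filter (¬? ∘ D?) us) →
          (∀ {u} → u ∈ us → S u) →
          ∀ b → Alternating us D b

        alternate m [] _ _ _ _ _ b = (λ _ → b) , (λ _ → col-∅ λ { _ (() , _) }) , λ ()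
        alternate (suc m) {A} {X} us@(z ∷ zs) len X? layering X⊆S us⊆S b
          with Any.any? (λ u → any? (λ x → X? x ×-dec adj? x u)) us
        ... | yes some =
          let β , fibres , first = alternate-from m len D? (Any-∈ some) proj₁
                (col-layer (restrict layering) D? X⊆S (us⊆S ∘ proj₁) proj₂)
                (next-layer layering proj₁ proj₂ (λ u∈ Xx xu → u∈ , _ , Xx , xu) D?) us⊆S b
          in β , fibres , λ u∈ xs → first u∈ (u∈ , xs)
          where
          D : VSet
          D u = u ∈ us × ∃[ x ] (X x × Adj x u)

          D? : U.Decidable D
          D? u = Any.any? (u ≟_) us ×-dec any? (λ x → X? x ×-dec adj? x u)

          Any-∈ : Any (λ u → ∃[ x ] (X x × Adj x u)) us → Any D us
          Any-∈ some = let u , u∈ , xs = find some in lose u∈ (u∈ , xs)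

          restrict : Layering A X (_∈ us) → Layering A X D
          restrict l = record
            { linked = linked ; A∩X = A∩X ; U∩A = U∩A ∘ proj₁ ; U∩X = U∩X ∘ proj₁ ; U≁A = U≁A ∘ proj₁ }
            where open Layering l
        -- The component is exhausted: the search restarts with the layer consisting of `z` alone
        -- and forgets the earlier layers.
        ... | no none =
          let β , fibres , _ = alternate-from m len (_≟ z) (here refl) (λ { refl → here refl })
                (col-singleton 1≤τ z) (first-layer z us) us⊆S b
          in β , fibres , λ u∈ xs → contradiction (lose u∈ xs) none

        alternate-from m {A} {D} {us} len D? some D⊆us col layering us⊆S b =
          β , fibres , λ _ → β-D
          where
          rest : List (Fin n)
          rest = filter (¬? ∘ D?) us

          shorter : length rest ≤ m
          shorter = s≤s⁻¹ (ℕₚ.≤-trans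
            (filter-notAll (¬? ∘ D?) us (Any.map (λ Du ¬Du → ¬Du Du) some)) len)

          ih : Alternating rest (λ u → ∃[ x ] (D x × Adj x u)) (not b)
          ih = alternate m rest shorter D? layering (us⊆S ∘ D⊆us)
            (us⊆S ∘ proj₁ ∘ ∈-filter⁻ (¬? ∘ D?)) (not b)

          β : Fin n → Bool
          β u with D? u
          ... | yes _ = b
          ... | no  _ = proj₁ ih u

          β-D : ∀ {u} → D u → β u ≡ b
          β-D {u} Du with D? u
          ... | yes _  = refl
          ... | no ¬Du = contradiction Du ¬Du

          fibres : ∀ b′ → Col K (λ u → u ∈ us × β u ≡ b′)
          fibres b′ = col-⊆ split (col-anticomplete (λ u → D? u ×-dec b Bool.≟ b′) anti
            (col-⊆ proj₁ col) (proj₁ (proj₂ ih) b′))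
            where
            anti : ∀ {u v} → D u × b ≡ b′ → v ∈ rest × proj₁ ih v ≡ b′ → ¬ Adj u v
            anti (Du , refl) (v∈ , eq) uv = Bool.not-¬ {b} refl (trans (sym eq) (proj₂ (proj₂ ih) v∈ (_ , Du , uv)))

            split : ∀ {u} → u ∈ us × β u ≡ b′ → (D u × b ≡ b′) ⊎ (u ∈ rest × proj₁ ih u ≡ b′)
            split {u} (u∈ , eq) with D? u
            ... | yes Du = inj₁ (Du , eq)
            ... | no ¬Du = inj₂ (∈-filter⁺ (¬? ∘ D?) u∈ ¬Du , eq)

        col-step : Col (K + K) S
        col-step =
          let us = filter S? (allFin n)
              S⊆us : ∀ {u} → S u → u ∈ us
              S⊆us Su = ∈-filter⁺ S? (∈-allFin _) Su
              -- Both `A` and `X` start empty, so the first round, if any, restarts at the head of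
              -- `us`.
              β , fibres , _ = alternate (length us) {λ _ → ⊥} {λ _ → ⊥} us ℕₚ.≤-refl (λ _ → no λ ())
                (record { linked = λ () ; A∩X = λ () ; U∩A = λ _ () ; U∩X = λ _ () ; U≁A = λ _ () })
                (λ ()) (proj₂ ∘ ∈-filter⁻ S? {xs = allFin n}) true
              split : ∀ {u} → S u → (S u × β u ≡ true) ⊎ (S u × β u ≡ false)
              split {u} Su = Sum.map (Su ,_) (Su ,_) (true-or-false (β u))
          in col-⊆ split (col-∪ (λ u → S? u ×-dec β u Bool.≟ true)
               (col-⊆ (λ (Su , eq) → S⊆us Su , eq) (fibres true))
               (col-⊆ (λ (Su , eq) → S⊆us Su , eq) (fibres false)))
          where
          true-or-false : ∀ b → b ≡ true ⊎ b ≡ false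
          true-or-false true  = inj₁ refl
          true-or-false false = inj₂ refl

  -- Induction on the clique number.

  -- Quantifying over vertex sets of the fixed graph keeps the hole conditions unchanged; the
  -- induction hypothesis is the `col-smaller` of `col-step`. For k = 0 there are no edges and one
  -- colour suffices.
  col-bound : ∀ {s} → 1 ≤ s → ¬ Hole G 5 → (∀ m → 2 + s < m → ¬ Hole G m) →
    ∀ k {S : VSet} → U.Decidable S → ¬ HasK (2 + k) S → Col (bound (s + (2 + s + 0)) k) S
  col-bound 1≤s no5 no-long zero S? ¬K =
    (λ _ → 0) , (λ _ → s≤s z≤n) , λ Su Sv uv _ → ¬K (_ , Su , _ , (Sv , uv) , tt)
  col-bound {s} 1≤s no5 no-long (suc k) S? ¬K =
    col-≤ (step-bound s _ 1≤τ) (col-step no5 (col-bound 1≤s no5 no-long k) S? ¬K 1≤s no-long 1≤τ)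
    where
    1≤τ = 1≤bound (ℕₚ.≤-trans 1≤s (ℕₚ.m≤m+n s _)) k

mainTheorem3 : ∀ (ℓ : ℕ) → 3 ≤ ℓ → ∀ {n : ℕ} (G : Graph n) →
    ¬ Hole G 5 →
    (∀ k → ℓ < k → ¬ Hole G k) →
    χ G ≤ (2 * ℓ ∸ 2) ^ (2 ^ ω G)
mainTheorem3 (suc (suc s)) (s≤s (s≤s 1≤s)) {n} G no5 no-long with cliqueNumber G
... | w , _ , w-max = ℕₚ.≤-trans (proj₂ (proj₂ (chromaticNumber G)) _ (col⇒colourable G (colouring w w-max))) (bound≤ w)
  where
  M : ℕ
  M = s + (2 + s + 0)

  1≤M : 1 ≤ M
  1≤M = ℕₚ.≤-trans 1≤s (ℕₚ.m≤m+n s _)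

  colouring : ∀ w → (∀ j → HasClique G j → j ≤ w) → Col G (bound M (w ∸ 1)) (λ _ → ⊤)
  -- Truncated subtraction lets ω = 0 share the case k = 0 with ω = 1.
  colouring w w-max = col-bound G 1≤s no5 no-long (w ∸ 1) (λ _ → yes tt) λ h →
    let S , clique , size , _ = hasK⇒clique G _ h
    in ℕₚ.<⇒≱ (s≤s (ℕₚ.m≤n+m∸n w 1)) (w-max _ (S , clique , size))

  bound≤ : ∀ w → bound M (w ∸ 1) ≤ M ^ (2 ^ w)
  bound≤ zero    = subst (1 ≤_) (sym (ℕₚ.*-identityʳ M)) 1≤M
  -- The spare factor M² is at least 1.
  bound≤ (suc k) = subst (bound M k ≤_) (bound*M² M k)
    (subst (_≤ bound M k * (M * M)) (ℕₚ.*-identityʳ _) (ℕₚ.*-monoʳ-≤ (bound M k) (ℕₚ.*-mono-≤ 1≤M 1≤M)))
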